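{- Let $G\in\mathcal E$ and let $A$ be a Left option of $G$ that is end-reversible modulo $\mathcal E$. Then there exists a smallest nonnegative integer $n$ such that $G\geq_{\mathcal E}M_n$, and for this $n$, $$G\equiv_{\mathcal E}\{\{\;\mid M_n\},\,G^{\mathcal L}\setminus\{A\}\mid G^{\mathcal R}\}.$$
   Context: All games are short two-player partizan games between Left and Right, identified with their game trees: $G=\{G^{\mathcal L}\mid G^{\mathcal R}\}$ with finite sets of options; $\mathbf 0=\{\;\mid\;\}$. Followers of $G$: $G$, its options, their options, etc. Disjunctive sum: $G+H=\{G^{\mathcal L}+H,G+H^{\mathcal L}\mid G^{\mathcal R}+H,G+H^{\mathcal R}\}$. Misère play: a player with no move on their turn wins. $o_L(G)=\mathrm L$ if $G^{\mathcal L}=\emptyset$, else $\max_{G^L}o_R(G^L)$; $o_R(G)=\mathrm R$ if $G^{\mathcal R}=\emptyset$, else $\min_{G^R}o_L(G^R)$; $\mathrm L>\mathrm R$; $o(G)=(o_L(G),o_R(G))$ ordered componentwise. A Left-end has no Left option; a dead Left-end has only Left-ends as followers; similarly Right. A game is dead-ending if each follower that is a Left-end (Right-end) is a dead Left-end (dead Right-end); $\mathcal E$ is the class of dead-ending games. $G\geq_{\mathcal E}H$ means $o(G+X)\geq o(H+X)$ for all $X\in\mathcal E$; $\equiv_{\mathcal E}$ means both directions. A Left option $A$ of $G$ is end-reversible (modulo $\mathcal E$) if $A$ has a Right option $B$ with no Left options and $B\leq_{\mathcal E}G$. Perfect murders: $M_0=\mathbf 0$, $M_n=\{\;\mid\mathbf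 0,M_{n-1}\}$ for $n>0$. -}

module Defs where

open import Data.Nat using (ℕ; zero; suc)
open import Data.List using (List; []; _∷_; _++_)
open import Data.List.Membership.Propositional using (_∈_)
open import Data.Product using (Σ; _×_)
open import Relation.Binary.PropositionalEquality using (_≡_)

-- Short partizan games as finite game trees: Left options, Right options.
-- (Option *sets* are represented by lists; duplicates are harmless.)
data Game : Set where
  mk : List Game → List Game → Game

leftOpts : Game → List Game
leftOpts (mk gl _) = gl

rightOpts : Game → List Game
rightOpts (mk _ gr) = gr

𝟎 : Game
𝟎 = mk [] []

mutual
  _⊕_ : Game → Game → Game
  mk gl gr ⊕ mk hl hr =
    mk (sumL gl (mk hl hr) ++ sumR gl gr hl)
       (sumL gr (mk hl hr) ++ sumR gl gr hr)

  sumL : List Game → Game → List Game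
  sumL [] h = []
  sumL (g ∷ gs) h = (g ⊕ h) ∷ sumL gs h

  sumR : List Game → List Game → List Game → List Game
  sumR gl gr [] = []
  sumR gl gr (h ∷ hs) = (mk gl gr ⊕ h) ∷ sumR gl gr hs

data Outcome : Set where
  L R : Outcome

data _≤O_ : Outcome → Outcome → Set where
  R≤ : ∀ {x} → R ≤O x
  L≤L : L ≤O L

_⊔O_ : Outcome → Outcome → Outcome
L ⊔O _ = L
R ⊔O y = y

_⊓O_ : Outcome → Outcome → Outcome
R ⊓O _ = R
L ⊓O y = y

mutual
  oL : Game → Outcome
  oL (mk [] _) = L
  oL (mk (g ∷ gs) _) = maxOR (g ∷ gs)

  oR : Game → Outcome
  oR (mk _ []) = R
  oR (mk _ (g ∷ gs)) = minOL (g ∷ gs)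

  maxOR : List Game → Outcome
  maxOR [] = R
  maxOR (g ∷ gs) = oR g ⊔O maxOR gs

  minOL : List Game → Outcome
  minOL [] = L
  minOL (g ∷ gs) = oL g ⊓O minOL gs

data Follower : Game → Game → Set where
  here  : ∀ {G} → Follower G G
  viaL  : ∀ {gl gr x H} → x ∈ gl → Follower x H → Follower (mk gl gr) H
  viaR  : ∀ {gl gr x H} → x ∈ gr → Follower x H → Follower (mk gl gr) H

LeftEnd : Game → Set
LeftEnd G = leftOpts G ≡ []

RightEnd : Game → Set
RightEnd G = rightOpts G ≡ []

DeadLeftEnd : Game → Set
DeadLeftEnd G = ∀ H → Follower G H → LeftEnd H

DeadRightEnd : Game → Set
DeadRightEnd G = ∀ H → Follower G H → RightEnd H

DeadEnding : Game → Set
DeadEnding G = ∀ H → Follower G H →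
  (LeftEnd H → DeadLeftEnd H) × (RightEnd H → DeadRightEnd H)

_≥E_ : Game → Game → Set
G ≥E H = ∀ X → DeadEnding X →
  (oL (H ⊕ X) ≤O oL (G ⊕ X)) × (oR (H ⊕ X) ≤O oR (G ⊕ X))

_≤E_ : Game → Game → Set
G ≤E H = H ≥E G

_≡E_ : Game → Game → Set
G ≡E H = (G ≥E H) × (H ≥E G)

EndReversible : Game → Game → Set
EndReversible G A = Σ Game (λ B → (B ∈ rightOpts A) × LeftEnd B × (B ≤E G))

M : ℕ → Game
M zero = 𝟎
M (suc n) = mk [] (𝟎 ∷ M n ∷ [])

-- Right can answer a move to A by moving to the left-end B ≤ G, after which Left either plays on
-- in X, where G does as well as B, or is already out of moves; in the latter case {∣ M n} serves as
-- well as A, for every n. Conversely Right can answer {∣ M n} by M n ≤ G. Hence any n with G ≥ M n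
-- gives the equivalence. Such an n exists because a dead left-end B is 𝟎 or ≥ M (size B).
--
-- A least n exists constructively because G ≥ M n is decidable: it holds iff
--   (1) Left wins G + X moving first for all dead left-ends X, where X = 𝟎 and X = M (size G)
--       suffice, as a long enough perfect murder is the worst nonzero dead left-end;
--   (2) n = 0 if G is a right-end;
--   (3) each right option K of G is ≥ a right option of M n or has a left option ≥ M n;
-- and a failure of any of these yields an explicit dead-ending game distinguishing G from M n.
module Submission where

open import Defs
open import Data.Nat using (ℕ; zero; suc; _+_; _≤_; _<_; z≤n; s≤s)
open import Data.Nat.Properties using (≤-refl; ≤-trans; ≤-pred; <⇒≤; m≤m+n; m≤n+m)
open import Data.List using (List; _∷_; []; map; _++_)
open import Data.List.Membership.Propositional using (_∈_)
open import Data.List.Membership.Propositional.Properties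
  using (∈-map⁺; ∈-map⁻; ∈-++⁺ˡ; ∈-++⁺ʳ; ∈-++⁻)
open import Data.List.Relation.Unary.All as All using (All; []; _∷_)
open import Data.List.Relation.Unary.Any using (here; there)
open import Data.Product using (Σ; ∃; _×_; _,_; proj₁; proj₂)
open import Data.Sum using (_⊎_; inj₁; inj₂; [_,_]′; swap)
open import Function.Base using (_∘_)
open import Function.Bundles using (_⇔_; Equivalence)
open import Relation.Binary.PropositionalEquality using (_≡_; _≢_; refl; sym; cong; cong₂; subst)
open import Relation.Nullary using (¬_; Dec; yes; no; contradiction)

private
  variable
    G H X g x K : Game
    gs hs : List Game

-- Lists and induction on game trees

¬∈[] : gs ≡ [] → ¬ x ∈ gs
¬∈[] refl ()

empty? : (gs : List Game) → gs ≡ [] ⊎ ∃ (_∈ gs)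
empty? []      = inj₁ refl
empty? (g ∷ _) = inj₂ (g , here refl)

∀⊎∃ : {P Q : Game → Set} (gs : List Game) → (∀ {x} → x ∈ gs → P x ⊎ Q x) →
      (∀ {x} → x ∈ gs → P x) ⊎ (∃ λ x → x ∈ gs × Q x)
∀⊎∃ []       f = inj₁ λ ()
∀⊎∃ (g ∷ gs) f with f (here refl) | ∀⊎∃ gs (f ∘ there)
... | inj₂ q | _                  = inj₂ (g , here refl , q)
... | inj₁ p | inj₂ (x , x∈ , q)  = inj₂ (x , there x∈ , q)
... | inj₁ p | inj₁ ps            = inj₁ λ { (here refl) → p ; (there x∈) → ps x∈ }

-- A finite form of choice. The backward correspondence ensures that a game with options `ys` has no
-- options other than chosen witnesses.
collect : {S : Game → Game → Set} (gs : List Game) → (∀ {x} → x ∈ gs → ∃ (S x)) →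
          Σ (List Game) λ ys → (∀ {x} → x ∈ gs → ∃ λ y → y ∈ ys × S x y)
                             × (∀ {y} → y ∈ ys → ∃ λ x → x ∈ gs × S x y)
collect []       f = [] , (λ ()) , (λ ())
collect (g ∷ gs) f with f (here refl) | collect gs (f ∘ there)
... | y , s | ys , to , from =
  y ∷ ys ,
  (λ { (here refl) → y , here refl , s
     ; (there x∈)  → let z , z∈ , t = to x∈ in z , there z∈ , t }) ,
  (λ { (here refl) → g , here refl , s
     ; (there y∈)  → let z , z∈ , t = from y∈ in z , there z∈ , t })

module _ (P : Game → Set)
         (step : ∀ G → (∀ {x} → x ∈ leftOpts G → P x) → (∀ {x} → x ∈ rightOpts G → P x) → P G) where
  mutual
    game-ind : ∀ G → P G
    game-ind (mk gl gr) = step (mk gl gr) (game-inds gl) (game-inds gr)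

    game-inds : ∀ gs {x} → x ∈ gs → P x
    game-inds (g ∷ gs) (here refl) = game-ind g
    game-inds (g ∷ gs) (there x∈)  = game-inds gs x∈

mutual
  size : Game → ℕ
  size (mk gl gr) = suc (sizes gl + sizes gr)

  sizes : List Game → ℕ
  sizes []       = 0
  sizes (g ∷ gs) = size g + sizes gs

size-∈ : x ∈ gs → size x ≤ sizes gs
size-∈ (here refl)             = m≤m+n _ _
size-∈ {gs = g ∷ _} (there x∈) = ≤-trans (size-∈ x∈) (m≤n+m _ (size g))

size-left : ∀ G → x ∈ leftOpts G → size x < size G
size-left (mk gl gr) x∈ = s≤s (≤-trans (size-∈ x∈) (m≤m+n _ _))

size-right : ∀ G → x ∈ rightOpts G → size x < size G
size-right (mk gl gr) x∈ = s≤s (≤-trans (size-∈ x∈) (m≤n+m _ (sizes gl)))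

-- Options of a sum

sumL≡map : ∀ gs → sumL gs H ≡ map (_⊕ H) gs
sumL≡map []       = refl
sumL≡map (g ∷ gs) = cong (_ ∷_) (sumL≡map gs)

sumR≡map : ∀ {gl gr} hs → sumR gl gr hs ≡ map (mk gl gr ⊕_) hs
sumR≡map []       = refl
sumR≡map (h ∷ hs) = cong (_ ∷_) (sumR≡map hs)

leftOpts-⊕ : ∀ G H → leftOpts (G ⊕ H) ≡ map (_⊕ H) (leftOpts G) ++ map (G ⊕_) (leftOpts H)
leftOpts-⊕ (mk gl gr) (mk hl hr) = cong₂ _++_ (sumL≡map gl) (sumR≡map hl)

rightOpts-⊕ : ∀ G H → rightOpts (G ⊕ H) ≡ map (_⊕ H) (rightOpts G) ++ map (G ⊕_) (rightOpts H)
rightOpts-⊕ (mk gl gr) (mk hl hr) = cong₂ _++_ (sumL≡map gr) (sumR≡map hr)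

-- Stated for any list `os` of this shape, so that `leftOpts-⊕` and `rightOpts-⊕` both supply
-- instances.
module _ {G H : Game} {gs hs os : List Game} (eq : os ≡ map (_⊕ H) gs ++ map (G ⊕_) hs) where

  ∈-⊕⁺ˡ : g ∈ gs → g ⊕ H ∈ os
  ∈-⊕⁺ˡ g∈ = subst (_ ∈_) (sym eq) (∈-++⁺ˡ (∈-map⁺ (_⊕ H) g∈))

  ∈-⊕⁺ʳ : x ∈ hs → G ⊕ x ∈ os
  ∈-⊕⁺ʳ x∈ = subst (_ ∈_) (sym eq) (∈-++⁺ʳ (map (_⊕ H) gs) (∈-map⁺ (G ⊕_) x∈))

  ∀-⊕ : {P : Game → Set} → (∀ {g} → g ∈ gs → P (g ⊕ H)) → (∀ {x} → x ∈ hs → P (G ⊕ x)) →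
        ∀ {y} → y ∈ os → P y
  ∀-⊕ p q y∈ with ∈-++⁻ (map (_⊕ H) gs) (subst (_ ∈_) eq y∈)
  ... | inj₁ y∈ˡ with ∈-map⁻ (_⊕ H) y∈ˡ
  ...   | _ , g∈ , refl = p g∈
  ∀-⊕ p q y∈ | inj₂ y∈ʳ with ∈-map⁻ (G ⊕_) y∈ʳ
  ...   | _ , x∈ , refl = q x∈

  []-⊕⁺ : gs ≡ [] → hs ≡ [] → os ≡ []
  []-⊕⁺ refl refl = eq

  []-⊕⁻ : os ≡ [] → gs ≡ [] × hs ≡ []
  []-⊕⁻ os≡[] with empty? gs | empty? hs
  ... | inj₁ p        | inj₁ q        = p , q
  ... | inj₂ (_ , g∈) | _             = contradiction (∈-⊕⁺ˡ g∈) (¬∈[] os≡[])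
  ... | inj₁ _        | inj₂ (_ , x∈) = contradiction (∈-⊕⁺ʳ x∈) (¬∈[] os≡[])

-- Outcomes

¬L⇒R : ∀ {o} → o ≢ L → o ≡ R
¬L⇒R {L} ¬l = contradiction refl ¬l
¬L⇒R {R} _  = refl

L≢R : ∀ {o} → o ≡ L → o ≢ R
L≢R refl ()

L? : ∀ o → o ≡ L ⊎ o ≡ R
L? L = inj₁ refl
L? R = inj₂ refl

L-stable : ∀ {o} → ¬ (o ≢ L) → o ≡ L
L-stable {L} _  = refl
L-stable {R} ¬¬ = contradiction (λ ()) ¬¬

≤O⁺ : ∀ {o p} → (o ≡ L → p ≡ L) → o ≤O p
≤O⁺ {R} _ = R≤
≤O⁺ {L} f rewrite f refl = L≤L

≤O⁻ : ∀ {o p} → o ≤O p → o ≡ L → p ≡ L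
≤O⁻ L≤L refl = refl

maxOR⁺ : x ∈ gs → oR x ≡ L → maxOR gs ≡ L
maxOR⁺ (here refl) eq rewrite eq = refl
maxOR⁺ {gs = g ∷ _} (there x∈) eq with oR g
... | L = refl
... | R = maxOR⁺ x∈ eq

maxOR⁻ : ∀ gs → maxOR gs ≡ L → ∃ λ x → x ∈ gs × oR x ≡ L
maxOR⁻ (g ∷ gs) eq with oR g in e
... | L = g , here refl , e
... | R = let x , x∈ , w = maxOR⁻ gs eq in x , there x∈ , w

minOL⁺ : ∀ gs → (∀ {x} → x ∈ gs → oL x ≡ L) → minOL gs ≡ L
minOL⁺ []       _ = refl
minOL⁺ (g ∷ gs) f rewrite f (here refl) = minOL⁺ gs (f ∘ there)

minOL⁻ : minOL gs ≡ L → x ∈ gs → oL x ≡ L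
minOL⁻ {g ∷ _} eq x∈ with oL g in e
minOL⁻ eq (here refl) | L = e
minOL⁻ eq (there x∈)  | L = minOL⁻ eq x∈

oL-end : ∀ G → LeftEnd G → oL G ≡ L
oL-end (mk [] _) _ = refl

oL-move : ∀ G → x ∈ leftOpts G → oR x ≡ L → oL G ≡ L
oL-move (mk (_ ∷ _) _) = maxOR⁺

oL⁻ : ∀ G → oL G ≡ L → LeftEnd G ⊎ (∃ λ x → x ∈ leftOpts G × oR x ≡ L)
oL⁻ (mk [] _)       _  = inj₁ refl
oL⁻ (mk (g ∷ gs) _) eq = inj₂ (maxOR⁻ (g ∷ gs) eq)

oR⁺ : ∀ G → ¬ RightEnd G → (∀ {x} → x ∈ rightOpts G → oL x ≡ L) → oR G ≡ L
oR⁺ (mk _ [])       ¬e _ = contradiction refl ¬e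
oR⁺ (mk _ (g ∷ gs)) _  f = minOL⁺ (g ∷ gs) f

oR⁻-end : ∀ G → oR G ≡ L → ¬ RightEnd G
oR⁻-end (mk _ []) () _

oR⁻ : ∀ G → oR G ≡ L → x ∈ rightOpts G → oL x ≡ L
oR⁻ (mk _ (_ ∷ _)) = minOL⁻

module _ (G X : Game) where
  private
    ls = leftOpts-⊕ G X
    rs = rightOpts-⊕ G X

  oL⊕-end : LeftEnd G → LeftEnd X → oL (G ⊕ X) ≡ L
  oL⊕-end p q = oL-end (G ⊕ X) ([]-⊕⁺ ls p q)

  oL⊕-moveˡ : g ∈ leftOpts G → oR (g ⊕ X) ≡ L → oL (G ⊕ X) ≡ L
  oL⊕-moveˡ g∈ = oL-move (G ⊕ X) (∈-⊕⁺ˡ ls g∈)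

  oL⊕-moveʳ : x ∈ leftOpts X → oR (G ⊕ x) ≡ L → oL (G ⊕ X) ≡ L
  oL⊕-moveʳ x∈ = oL-move (G ⊕ X) (∈-⊕⁺ʳ ls x∈)

  oL⊕⁻ : {C : Set} → (LeftEnd G → LeftEnd X → C) →
         (∀ {g} → g ∈ leftOpts G → oR (g ⊕ X) ≡ L → C) →
         (∀ {x} → x ∈ leftOpts X → oR (G ⊕ x) ≡ L → C) →
         oL (G ⊕ X) ≡ L → C
  oL⊕⁻ {C} e p q w with oL⁻ (G ⊕ X) w
  ... | inj₁ end            = let a , b = []-⊕⁻ ls end in e a b
  ... | inj₂ (y , y∈ , won) = ∀-⊕ ls {P = λ y → oR y ≡ L → C} p q y∈ won

  oR⊕⁺ : ¬ (RightEnd G × RightEnd X) →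
         (∀ {g} → g ∈ rightOpts G → oL (g ⊕ X) ≡ L) →
         (∀ {x} → x ∈ rightOpts X → oL (G ⊕ x) ≡ L) → oR (G ⊕ X) ≡ L
  oR⊕⁺ ¬e p q = oR⁺ (G ⊕ X) (¬e ∘ []-⊕⁻ rs) (∀-⊕ rs {P = λ y → oL y ≡ L} p q)

  oR⊕⁻-end : oR (G ⊕ X) ≡ L → ¬ (RightEnd G × RightEnd X)
  oR⊕⁻-end w (p , q) = oR⁻-end (G ⊕ X) w ([]-⊕⁺ rs p q)

  oR⊕⁻ˡ : oR (G ⊕ X) ≡ L → g ∈ rightOpts G → oL (g ⊕ X) ≡ L
  oR⊕⁻ˡ w g∈ = oR⁻ (G ⊕ X) w (∈-⊕⁺ˡ rs g∈)

  oR⊕⁻ʳ : oR (G ⊕ X) ≡ L → x ∈ rightOpts X → oL (G ⊕ x) ≡ L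
  oR⊕⁻ʳ w x∈ = oR⁻ (G ⊕ X) w (∈-⊕⁺ʳ rs x∈)

  oL⊕≡R : ¬ (LeftEnd G × LeftEnd X) →
          (∀ {g} → g ∈ leftOpts G → oR (g ⊕ X) ≡ R) →
          (∀ {x} → x ∈ leftOpts X → oR (G ⊕ x) ≡ R) → oL (G ⊕ X) ≡ R
  oL⊕≡R ¬e p q = ¬L⇒R (oL⊕⁻ (λ a b → ¬e (a , b)) (λ g∈ w → L≢R w (p g∈)) (λ x∈ w → L≢R w (q x∈)))

  oR⊕≡R-end : RightEnd G → RightEnd X → oR (G ⊕ X) ≡ R
  oR⊕≡R-end p q = ¬L⇒R λ w → oR⊕⁻-end w (p , q)

  oR⊕≡R-moveˡ : g ∈ rightOpts G → oL (g ⊕ X) ≡ R → oR (G ⊕ X) ≡ R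
  oR⊕≡R-moveˡ g∈ lost = ¬L⇒R λ w → L≢R (oR⊕⁻ˡ w g∈) lost

  oR⊕≡R-moveʳ : x ∈ rightOpts X → oL (G ⊕ x) ≡ R → oR (G ⊕ X) ≡ R
  oR⊕≡R-moveʳ x∈ lost = ¬L⇒R λ w → L≢R (oR⊕⁻ʳ w x∈) lost

-- Ends and dead-ending games

follower-left : ∀ G → x ∈ leftOpts G → Follower x H → Follower G H
follower-left (mk _ _) = viaL

follower-right : ∀ G → x ∈ rightOpts G → Follower x H → Follower G H
follower-right (mk _ _) = viaR

deadEnding-left : ∀ G → DeadEnding G → x ∈ leftOpts G → DeadEnding x
deadEnding-left G d x∈ H f = d H (follower-left G x∈ f)

deadEnding-right : ∀ G → DeadEnding G → x ∈ rightOpts G → DeadEnding x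
deadEnding-right G d x∈ H f = d H (follower-right G x∈ f)

deadLeftEnd-right : ∀ G → DeadLeftEnd G → x ∈ rightOpts G → DeadLeftEnd x
deadLeftEnd-right G d x∈ H f = d H (follower-right G x∈ f)

follower-trans : Follower G H → Follower H X → Follower G X
follower-trans here        q = q
follower-trans (viaL x∈ p) q = viaL x∈ (follower-trans p q)
follower-trans (viaR x∈ p) q = viaR x∈ (follower-trans p q)

-- A right-end among the followers has no options on either side, so it is its own only follower.
deadLeftEnd⇒deadEnding : DeadLeftEnd G → DeadEnding G
deadLeftEnd⇒deadEnding d H f = (λ _ K q → d K (follower-trans f q)) , λ re K → λ where
  here                  → re
  (viaL x∈ q)           → contradiction x∈ (¬∈[] (d H f))
  (viaR x∈ q)           → contradiction x∈ (¬∈[] re)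

deadRightEnd⇒deadEnding : DeadRightEnd G → DeadEnding G
deadRightEnd⇒deadEnding d H f = (λ le K → λ where
  here                  → le
  (viaL x∈ q)           → contradiction x∈ (¬∈[] le)
  (viaR x∈ q)           → contradiction x∈ (¬∈[] (d H f))) , λ _ K q → d K (follower-trans f q)

-- Options on both sides keep the new game from being an end, so only followers of its options
-- matter.
deadEnding-mk : ∀ {g h} → All DeadEnding (g ∷ gs) → All DeadEnding (h ∷ hs) →
                DeadEnding (mk (g ∷ gs) (h ∷ hs))
deadEnding-mk p q H here        = (λ ()) , (λ ())
deadEnding-mk p q H (viaL x∈ f) = All.lookup p x∈ H f
deadEnding-mk p q H (viaR x∈ f) = All.lookup q x∈ H f

M-deadLeftEnd : ∀ n → DeadLeftEnd (M n)
M-deadLeftEnd zero    H here                        = refl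
M-deadLeftEnd (suc n) H here                        = refl
M-deadLeftEnd (suc n) H (viaR (here refl) f)        = M-deadLeftEnd 0 H f
M-deadLeftEnd (suc n) H (viaR (there (here refl)) f) = M-deadLeftEnd n H f

M-leftEnd : ∀ n → LeftEnd (M n)
M-leftEnd n = M-deadLeftEnd n (M n) here

M-deadEnding : ∀ n → DeadEnding (M n)
M-deadEnding n = deadLeftEnd⇒deadEnding (M-deadLeftEnd n)

-- Reserves of Left moves

integer : ℕ → Game
integer zero    = 𝟎
integer (suc m) = mk (integer m ∷ []) []

integer-rightEnd : ∀ m → RightEnd (integer m)
integer-rightEnd zero    = refl
integer-rightEnd (suc m) = refl

integer-deadRightEnd : ∀ m → DeadRightEnd (integer m)
integer-deadRightEnd zero    H here                 = refl
integer-deadRightEnd (suc m) H here                 = refl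
integer-deadRightEnd (suc m) H (viaL (here refl) f) = integer-deadRightEnd m H f

integer-deadEnding : ∀ m → DeadEnding (integer m)
integer-deadEnding m = deadRightEnd⇒deadEnding (integer-deadRightEnd m)

-- The bound is strict when Left starts, since she may spend one move of the integer before Right
-- replies.
RightSurvives : Game → Set
RightSurvives G = ∀ m → (size G ≤ m → oR (G ⊕ integer m) ≡ R) × (size G < m → oL (G ⊕ integer m) ≡ R)

-- Right makes arbitrary moves: Left always has a move left in the integer.
right-survives : ∀ G → RightSurvives G
right-survives = game-ind RightSurvives λ G ihL ihR m →
  let first : ∀ m → size G ≤ m → oR (G ⊕ integer m) ≡ R
      first m b = [ (λ e → oR⊕≡R-end G (integer m) e (integer-rightEnd m))
                  , (λ (g , g∈) → oR⊕≡R-moveˡ G (integer m) g∈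
                                    (proj₂ (ihR g∈ m) (≤-trans (size-right G g∈) b))) ]′
                  (empty? (rightOpts G))
  in first m , λ where
    (s≤s {n = k} b) → oL⊕≡R G (integer (suc k)) (λ ())
      (λ g∈ → proj₁ (ihL g∈ (suc k)) (≤-trans (<⇒≤ (size-left G g∈)) (≤-trans b (m≤n+m k 1))))
      (λ { (here refl) → first k b })

-- Comparison with perfect murders

≥E⁺ : ∀ G H →
      (∀ X → DeadEnding X →
        (oL (H ⊕ X) ≡ L → oL (G ⊕ X) ≡ L) × (oR (H ⊕ X) ≡ L → oR (G ⊕ X) ≡ L)) →
      G ≥E H
≥E⁺ G H f X d = ≤O⁺ (proj₁ (f X d)) , ≤O⁺ (proj₂ (f X d))

≥E-oL : ∀ G H → G ≥E H → DeadEnding X → oL (H ⊕ X) ≡ L → oL (G ⊕ X) ≡ L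
≥E-oL G H ge d = ≤O⁻ (proj₁ (ge _ d))

≥E-oR : ∀ G H → G ≥E H → DeadEnding X → oR (H ⊕ X) ≡ L → oR (G ⊕ X) ≡ L
≥E-oR G H ge d = ≤O⁻ (proj₂ (ge _ d))

≥E-refl : ∀ G → G ≥E G
≥E-refl G = ≥E⁺ G G λ _ _ → (λ w → w) , (λ w → w)

≥E-trans : ∀ G H K → G ≥E H → H ≥E K → G ≥E K
≥E-trans G H K p q = ≥E⁺ G K λ _ d →
  (≥E-oL G H p d ∘ ≥E-oL H K q d) , (≥E-oR G H p d ∘ ≥E-oR H K q d)

LeftStrong : Game → Set
LeftStrong G = ∀ X → DeadLeftEnd X → oL (G ⊕ X) ≡ L

Answered : ℕ → Game → Set
Answered n K = (∃ λ H → H ∈ rightOpts (M n) × K ≥E H) ⊎ (∃ λ G → G ∈ leftOpts K × G ≥E M n)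

-- Induction on `X`. Left has no moves in `M n`, so she either copies a move in `X` or faces a
-- left-end `X`, where `strong` applies.
≥M⁺ : ∀ G n → LeftStrong G → (RightEnd G → n ≡ 0) →
      (∀ {K} → K ∈ rightOpts G → Answered n K) → G ≥E M n
≥M⁺ G n strong end answer = ≥E⁺ G (M n) (game-ind Goal step)
  where
  Goal : Game → Set
  Goal X = DeadEnding X → (oL (M n ⊕ X) ≡ L → oL (G ⊕ X) ≡ L) × (oR (M n ⊕ X) ≡ L → oR (G ⊕ X) ≡ L)

  step : ∀ X → (∀ {x} → x ∈ leftOpts X → Goal x) → (∀ {x} → x ∈ rightOpts X → Goal x) → Goal X
  step X ihL ihR d =
    oL⊕⁻ (M n) X
      (λ _ e → strong X (proj₁ (d X here) e))
      (λ g∈ _ → contradiction g∈ (¬∈[] (M-leftEnd n)))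
      (λ x∈ w → oL⊕-moveʳ G X x∈ (proj₂ (ihL x∈ (deadEnding-left X d x∈)) w)) ,
    λ w → oR⊕⁺ G X
      -- A right-end `G` forces `n` to be `0`; if `X` were a right-end too, Right would win
      -- `M n ⊕ X` at once, against `w`.
      (λ (e , e′) → oR⊕⁻-end (M n) X w (subst (RightEnd ∘ M) (sym (end e)) refl , e′))
      (λ {K} K∈ → [ (λ (H , H∈ , ge) → ≥E-oL K H ge d (oR⊕⁻ˡ (M n) X w H∈))
                  , (λ (G′ , G′∈ , ge) → oL⊕-moveˡ K X G′∈ (≥E-oR G′ (M n) ge d w)) ]′ (answer K∈))
      (λ x∈ → proj₁ (ihR x∈ (deadEnding-right X d x∈)) (oR⊕⁻ʳ (M n) X w x∈))

MurderIsWorst : Game → Set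
MurderIsWorst G = ∀ X → DeadLeftEnd X → ¬ RightEnd X → ∀ j →
  (size G ≤ j → oL (G ⊕ M j) ≡ L → oL (G ⊕ X) ≡ L) ×
  (size G < j → oR (G ⊕ M j) ≡ L → oR (G ⊕ X) ≡ L)

-- Right can match in `M j` his moves in `X`: a move to `𝟎` by `𝟎`, any other by the next smaller
-- murder. The murder lasts long enough because Left can move in neither end and so shrinks `G`
-- between any two moves of Right.
murder-is-worst : ∀ G → MurderIsWorst G
murder-is-worst = game-ind MurderIsWorst λ G ihL ihR →
  -- Left's turn needs only the hypothesis on options of `G`, so `first` also covers the position
  -- after Right moves in `X`, without induction on `X`.
  let first : ∀ X → DeadLeftEnd X → ¬ RightEnd X → ∀ j → size G ≤ j → oL (G ⊕ M j) ≡ L → oL (G ⊕ X) ≡ L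
      first X d ¬e j b = oL⊕⁻ G (M j)
        (λ e _ → oL⊕-end G X e (d X here))
        (λ g∈ w → oL⊕-moveˡ G X g∈ (proj₂ (ihL g∈ X d ¬e j) (≤-trans (size-left G g∈) b) w))
        (λ x∈ _ → contradiction x∈ (¬∈[] (M-leftEnd j)))
  in λ X d ¬e j → first X d ¬e j , λ where
    (s≤s {n = k} b) w → oR⊕⁺ G X (¬e ∘ proj₂)
      (λ g∈ → proj₁ (ihR g∈ X d ¬e (suc k))
                (≤-trans (<⇒≤ (size-right G g∈)) (≤-trans b (m≤n+m k 1)))
                (oR⊕⁻ˡ G (M (suc k)) w g∈))
      (λ {x} x∈ → reply (deadLeftEnd-right X d x∈) (empty? (rightOpts x)) first b w)
  where
  reply : ∀ {k} → DeadLeftEnd x → RightEnd x ⊎ ∃ (_∈ rightOpts x) →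
          (∀ X → DeadLeftEnd X → ¬ RightEnd X → ∀ j → size G ≤ j → oL (G ⊕ M j) ≡ L → oL (G ⊕ X) ≡ L) →
          size G ≤ k → oR (G ⊕ M (suc k)) ≡ L → oL (G ⊕ x) ≡ L
  reply {x = mk (_ ∷ _) []} d (inj₁ refl) _ _ w = contradiction (d _ here) λ ()
  reply {x = mk [] []} {G = G} {k = k} d (inj₁ refl) _ _ w = oR⊕⁻ʳ G (M (suc k)) w (here refl)
  reply {x = x} {G = G} {k = k} d (inj₂ (_ , y∈)) first b w =
    first x d (λ e → ¬∈[] e y∈) k b (oR⊕⁻ʳ G (M (suc k)) w (there (here refl)))

end⇒≡𝟎 : ∀ X → LeftEnd X → RightEnd X → X ≡ 𝟎
end⇒≡𝟎 (mk [] []) refl refl = refl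

leftStrong⁺ : ∀ G → oL (G ⊕ 𝟎) ≡ L → oL (G ⊕ M (size G)) ≡ L → LeftStrong G
leftStrong⁺ G w₀ w X d with empty? (rightOpts X)
... | inj₁ e        = subst (λ Y → oL (G ⊕ Y) ≡ L) (sym (end⇒≡𝟎 X (d X here) e)) w₀
... | inj₂ (_ , x∈) = proj₁ (murder-is-worst G X d (λ e → ¬∈[] e x∈) (size G)) ≤-refl w

-- Distinguishing games

-- Failure of `≥E` as explicit data, so that witnesses for options can be assembled into one for the
-- whole game.
DistL DistR : Game → Game → Set
DistL G H = ∃ λ X → DeadEnding X × oL (G ⊕ X) ≡ R × oL (H ⊕ X) ≡ L
DistR G H = ∃ λ X → DeadEnding X × oR (G ⊕ X) ≡ R × oR (H ⊕ X) ≡ L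

distL⇒≱ : ∀ G H → DistL G H → ¬ G ≥E H
distL⇒≱ G H (X , d , lost , won) ge = L≢R (≥E-oL G H ge d won) lost

distL⇒distR : ∀ G n → DistL G (M n) → DistR G (M n)
distL⇒distR G n (Y , d , lost , won) = T ,
  deadEnding-mk (M-deadEnding 1 ∷ []) (d ∷ []) ,
  oR⊕≡R-moveʳ G T (here refl) lost ,
  oR⊕⁺ (M n) T (λ ())
    (λ {H} H∈ →
      let dH = deadLeftEnd-right (M n) (M-deadLeftEnd n) H∈ in
      -- Left retreats to `M 1`, leaving two left-ends. Unlike `𝟎`, `M 1` obliges Right to move even
      -- if `H` is `𝟎`, after which Left has no move and wins.
      oL⊕-moveʳ H T (here refl) (oR⊕⁺ H (M 1) (λ ())
        (λ {K} K∈ → oL⊕-end K (M 1) (deadLeftEnd-right H dH K∈ K here) refl)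
        (λ { (here refl)         → oL⊕-end H 𝟎 (dH H here) refl
           ; (there (here refl)) → oL⊕-end H 𝟎 (dH H here) refl })))
    (λ { (here refl) → won })
  where T = mk (M 1 ∷ []) (Y ∷ [])

-- Left's move to `X` wins with `H` and loses with `G`. Her moves in `G` are met by Right's retreat
-- to `integer m`; as they shrink `G`, `m = size G` meets the strict bound.
distR⇒distL : ∀ G H → DistR G H → DistL G H
distR⇒distL G H (X , d , lost , won) = Y ,
  deadEnding-mk (d ∷ []) (integer-deadEnding m ∷ []) ,
  oL⊕≡R G Y (λ ())
    (λ {g} g∈ → oR⊕≡R-moveʳ g Y (here refl) (proj₂ (right-survives g m) (size-left G g∈)))
    (λ { (here refl) → lost }) ,
  oL⊕-moveʳ H Y (here refl) won
  where
  m = size G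
  Y = mk (X ∷ []) (integer m ∷ [])

-- The distinguishing game T answers each Left move from K by a right option of T, and each
-- Right move from M n by a left option; integer and 𝟎 only keep T from being an end.
unanswered⇒downlinked : ∀ K n → (∀ {H} → H ∈ rightOpts (M n) → DistR K H) →
  (∀ {G} → G ∈ leftOpts K → DistL G (M n)) →
  ∃ λ T → DeadEnding T × oL (K ⊕ T) ≡ R × oR (M n ⊕ T) ≡ L
unanswered⇒downlinked K n r l with collect (rightOpts (M n)) r | collect (leftOpts K) l
... | Xs , toX , fromX | Ys , toY , fromY = T ,
  deadEnding-mk
    (integer-deadEnding m ∷ All.tabulate λ x∈ → proj₁ (proj₂ (proj₂ (fromX x∈))))
    (M-deadEnding 0 ∷ All.tabulate λ y∈ → proj₁ (proj₂ (proj₂ (fromY y∈)))) ,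
  oL⊕≡R K T (λ ())
    (λ {G} G∈ → let Y , Y∈ , _ , lost , _ = toY G∈ in oR⊕≡R-moveʳ G T (there Y∈) lost)
    -- Right is next to move here, so the weak bound on `m` suffices.
    (λ { (here refl) → proj₁ (right-survives K m) ≤-refl
       ; (there x∈)  → let _ , _ , _ , lost , _ = fromX x∈ in lost }) ,
  oR⊕⁺ (M n) T (λ ())
    (λ {H} H∈ → let X , X∈ , _ , _ , won = toX H∈ in oL⊕-moveʳ H T (there X∈) won)
    (λ { (here refl) → oL⊕-end (M n) 𝟎 (M-leftEnd n) refl
       ; (there y∈)  → let _ , _ , _ , _ , won = fromY y∈ in won })
  where
  m = size K
  T = mk (integer m ∷ Xs) (𝟎 ∷ Ys)

-- Deciding comparison with perfect murders

MurderTest : Game → Set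
MurderTest G = ∀ n → G ≥E M n ⊎ DistL G (M n)

answered? : ∀ n K → MurderTest K → (∀ {G} → G ∈ leftOpts K → MurderTest G) →
  Answered n K ⊎ (∃ λ T → DeadEnding T × oL (K ⊕ T) ≡ R × oR (M n ⊕ T) ≡ L)
answered? n K testK testL
  with ∀⊎∃ {Q = K ≥E_} (rightOpts (M n)) (swap ∘ option n)
     | ∀⊎∃ {Q = _≥E M n} (leftOpts K) (λ G∈ → swap (testL G∈ n))
  where
  -- Right options of a murder are murders again, `𝟎` being `M 0`, so `testK` applies to each.
  option : ∀ n → H ∈ rightOpts (M n) → K ≥E H ⊎ DistR K H
  option (suc n) (here refl)         = [ inj₁ , inj₂ ∘ distL⇒distR K 0 ]′ (testK 0)
  option (suc n) (there (here refl)) = [ inj₁ , inj₂ ∘ distL⇒distR K n ]′ (testK n)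
... | inj₂ a | _      = inj₁ (inj₁ a)
... | inj₁ _ | inj₂ a = inj₁ (inj₂ a)
... | inj₁ r | inj₁ l = inj₂ (unanswered⇒downlinked K n r l)

rightEnd? : ∀ G n → (RightEnd G → n ≡ 0) ⊎ DistR G (M n)
rightEnd? G zero    = inj₁ λ _ → refl
rightEnd? G (suc n) with empty? (rightOpts G)
... | inj₂ (_ , g∈) = inj₁ λ e → contradiction g∈ (¬∈[] e)
-- With nothing added, Right to move wins `G` at once, while in `M (suc n)` he must move to a
-- left-end.
... | inj₁ e        = inj₂ (𝟎 , M-deadEnding 0 , oR⊕≡R-end G 𝟎 e refl ,
  oR⊕⁺ (M (suc n)) 𝟎 (λ ())
    (λ { (here refl) → refl ; (there (here refl)) → oL⊕-end (M n) 𝟎 (M-leftEnd n) refl }) (λ ()))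

-- Both test games are left-ends, as is `M n`, so Left to move wins their sum with `M n` at once; a
-- test that fails for `G` therefore distinguishes.
leftStrong? : ∀ G n → LeftStrong G ⊎ DistL G (M n)
leftStrong? G n with L? (oL (G ⊕ 𝟎)) | L? (oL (G ⊕ M (size G)))
... | inj₁ w₀ | inj₁ w    = inj₁ (leftStrong⁺ G w₀ w)
... | inj₂ lost | _       = inj₂ (𝟎 , M-deadEnding 0 , lost , oL⊕-end (M n) 𝟎 (M-leftEnd n) refl)
... | inj₁ _ | inj₂ lost  = inj₂ (M (size G) , M-deadEnding (size G) , lost ,
                                  oL⊕-end (M n) (M (size G)) (M-leftEnd n) (M-leftEnd (size G)))

murder-test-step : ∀ G → (∀ {K} → K ∈ rightOpts G → MurderTest K × (∀ {x} → x ∈ leftOpts K → MurderTest x)) →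
                   MurderTest G
murder-test-step G ih n
  with leftStrong? G n | rightEnd? G n
     | ∀⊎∃ (rightOpts G) (λ {K} K∈ → answered? n K (proj₁ (ih K∈)) (proj₂ (ih K∈)))
... | inj₂ dist | _         | _            = inj₂ dist
... | inj₁ _    | inj₂ dist | _            = inj₂ (distR⇒distL G (M n) dist)
... | inj₁ s    | inj₁ e    | inj₁ answers = inj₁ (≥M⁺ G n s e answers)
... | inj₁ _    | inj₁ _    | inj₂ (K , K∈ , T , d , lost , won) =
  inj₂ (distR⇒distL G (M n) (T , d , oR⊕≡R-moveˡ G T K∈ lost , won))

murder-test : ∀ G → MurderTest G
-- The invariant includes the Left options because testing `G` looks two levels down, at Left
-- options of its Right options.
murder-test G = proj₁ (game-ind (λ G → MurderTest G × (∀ {x} → x ∈ leftOpts G → MurderTest x))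
  (λ G ihL ihR → murder-test-step G ihR , λ x∈ → proj₁ (ihL x∈)) G)

≥M? : ∀ G n → Dec (G ≥E M n)
≥M? G n = [ yes , no ∘ distL⇒≱ G (M n) ]′ (murder-test G n)

-- Least witnesses, and perfect murders below dead left-ends

least : {P : ℕ → Set} → (∀ n → Dec (P n)) → ∀ k → P k → Σ ℕ λ n → P n × (∀ m → P m → n ≤ m)
least P? zero    p = zero , p , λ _ _ → z≤n
least P? (suc k) p with P? 0
... | yes p₀ = zero , p₀ , λ _ _ → z≤n
... | no ¬p₀ with least (P? ∘ suc) k p
...   | n , pn , min = suc n , pn , λ where
  zero    p₀ → contradiction p₀ ¬p₀
  (suc m) pm → s≤s (min m pm)

-- Each right option of `B` is `𝟎`, itself an option of `M (suc k)`, or a smaller nonzero dead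
-- left-end, which dominates `M k` by induction.
deadLeftEnd≥M : ∀ B k → DeadLeftEnd B → ¬ RightEnd B → size B ≤ k → B ≥E M k
deadLeftEnd≥M B (suc k) d ¬e b = ≥M⁺ B (suc k)
  (λ X dX → oL⊕-end B X (d B here) (dX X here))
  (λ e → contradiction e ¬e)
  (λ {K} K∈ → inj₁ (answer K (deadLeftEnd-right B d K∈) (≤-pred (≤-trans (size-right B K∈) b))))
  where
  answer : ∀ K → DeadLeftEnd K → size K ≤ k → ∃ λ H → H ∈ rightOpts (M (suc k)) × K ≥E H
  answer K dK b′ with empty? (rightOpts K)
  ... | inj₁ e        = 𝟎 , here refl , subst (_≥E 𝟎) (sym (end⇒≡𝟎 K (dK K here) e)) (≥E-refl 𝟎)
  ... | inj₂ (_ , x∈) = M k , there (here refl) , deadLeftEnd≥M K k dK (λ e → ¬∈[] e x∈) b′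
deadLeftEnd≥M (mk _ _) zero _ _ ()

deadLeftEnd≥someM : ∀ B → DeadLeftEnd B → ∃ λ k → B ≥E M k
deadLeftEnd≥someM B d with empty? (rightOpts B)
... | inj₁ e        = 0 , subst (_≥E 𝟎) (sym (end⇒≡𝟎 B (d B here) e)) (≥E-refl 𝟎)
... | inj₂ (_ , x∈) = size B , deadLeftEnd≥M B (size B) d (λ e → ¬∈[] e x∈) ≤-refl

-- Replacing the reversible option

module Replacement (G A : Game) (A∈ : A ∈ leftOpts G) (rev : EndReversible G A)
                   (n : ℕ) (G≥M : G ≥E M n) (GL′ : List Game)
                   (remaining : ∀ x → (x ∈ GL′) ⇔ ((x ∈ leftOpts G) × (x ≢ A))) where

  private
    murder = mk [] (M n ∷ [])
    G′ = mk (murder ∷ GL′) (rightOpts G)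

    B = proj₁ rev
    B∈ : B ∈ rightOpts A
    B∈ = proj₁ (proj₂ rev)
    B-leftEnd : LeftEnd B
    B-leftEnd = proj₁ (proj₂ (proj₂ rev))
    G≥B : G ≥E B
    G≥B = proj₂ (proj₂ (proj₂ rev))

  G≥G′ : G ≥E G′
  G≥G′ = ≥E⁺ G G′ (game-ind Goal step)
    where
    Goal : Game → Set
    Goal X = DeadEnding X → (oL (G′ ⊕ X) ≡ L → oL (G ⊕ X) ≡ L) × (oR (G′ ⊕ X) ≡ L → oR (G ⊕ X) ≡ L)

    step : ∀ X → (∀ {x} → x ∈ leftOpts X → Goal x) → (∀ {x} → x ∈ rightOpts X → Goal x) → Goal X
    step X ihL ihR d =
      oL⊕⁻ G′ X (λ ())
        -- A winning move to `murder` survives Right's reply `M n`, so Left moving first wins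
        -- `M n ⊕ X`, hence `G ⊕ X`.
        (λ { (here refl) w → ≥E-oL G (M n) G≥M d (oR⊕⁻ˡ murder X w (here refl))
           ; (there g∈) w  → oL⊕-moveˡ G X (proj₁ (Equivalence.to (remaining _) g∈)) w })
        (λ x∈ w → oL⊕-moveʳ G X x∈ (proj₂ (ihL x∈ (deadEnding-left X d x∈)) w)) ,
      λ w → oR⊕⁺ G X (oR⊕⁻-end G′ X w) (oR⊕⁻ˡ G′ X w)
        (λ x∈ → proj₁ (ihR x∈ (deadEnding-right X d x∈)) (oR⊕⁻ʳ G′ X w x∈))

  G′≥G : G′ ≥E G
  G′≥G = ≥E⁺ G′ G (game-ind Goal step)
    where
    Goal : Game → Set
    Goal X = DeadEnding X → (oL (G ⊕ X) ≡ L → oL (G′ ⊕ X) ≡ L) × (oR (G ⊕ X) ≡ L → oR (G′ ⊕ X) ≡ L)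

    step : ∀ X → (∀ {x} → x ∈ leftOpts X → Goal x) → (∀ {x} → x ∈ rightOpts X → Goal x) → Goal X
    step X ihL ihR d =
      oL⊕⁻ G X
        (λ e _ → contradiction A∈ (¬∈[] e))
        -- Equality with A need not be decided, since the conclusion is ¬¬-stable.
        (λ {g} g∈ w → L-stable λ ¬won → ¬won (kept g∈ w λ { refl → ¬won (through-B w) }))
        moveX ,
      λ w → oR⊕⁺ G′ X (oR⊕⁻-end G X w) (oR⊕⁻ˡ G X w)
        (λ x∈ → proj₁ (ihR x∈ (deadEnding-right X d x∈)) (oR⊕⁻ʳ G X w x∈))
      where
      moveX : x ∈ leftOpts X → oR (G ⊕ x) ≡ L → oL (G′ ⊕ X) ≡ L
      moveX x∈ w = oL⊕-moveʳ G′ X x∈ (proj₂ (ihL x∈ (deadEnding-left X d x∈)) w)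

      kept : g ∈ leftOpts G → oR (g ⊕ X) ≡ L → g ≢ A → oL (G′ ⊕ X) ≡ L
      kept g∈ w g≢A = oL⊕-moveˡ G′ X (there (Equivalence.from (remaining _) (g∈ , g≢A))) w

      through-B : oR (A ⊕ X) ≡ L → oL (G′ ⊕ X) ≡ L
      through-B w = oL⊕⁻ B X
        -- Here `X` is a dead left-end. After Left moves to `murder`, Right has to move, and any
        -- move leaves Left without one.
        (λ _ e → let dX = proj₁ (d X here) e in
          oL⊕-moveˡ G′ X (here refl) (oR⊕⁺ murder X (λ ())
            (λ { (here refl) → oL⊕-end (M n) X (M-leftEnd n) e })
            (λ {x} x∈ → oL⊕-end murder x refl (deadLeftEnd-right X dX x∈ x here))))
        (λ b∈ _ → contradiction b∈ (¬∈[] B-leftEnd))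
        -- Left's winning move in `X` also wins beside `G`, because `G` dominates `B`; induction on
        -- `X` carries it over to `G′`.
        (λ x∈ w′ → moveX x∈ (≥E-oR G B G≥B (deadEnding-left X d x∈) w′))
        (oR⊕⁻ˡ A X w B∈)

mainTheorem10 : (G A : Game) → DeadEnding G → A ∈ leftOpts G → EndReversible G A →
    Σ ℕ (λ n → (G ≥E M n) × (∀ m → G ≥E M m → n ≤ m) ×
      ((GL' : List Game) → (∀ x → (x ∈ GL') ⇔ ((x ∈ leftOpts G) × (x ≢ A))) →
        G ≡E mk (mk [] (M n ∷ []) ∷ GL') (rightOpts G)))
mainTheorem10 G A dG A∈ rev@(B , B∈ , B-leftEnd , G≥B)
  -- `B` is a follower of the dead-ending game `G`, so as a left-end it is dead.
  with deadLeftEnd≥someM B (proj₁ (dG B (follower-left G A∈ (follower-right A B∈ here))) B-leftEnd)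
... | k , B≥M with least (≥M? G) k (≥E-trans G B (M k) G≥B B≥M)
...   | n , G≥M , minimal = n , G≥M , minimal , λ GL′ remaining →
  let open Replacement G A A∈ rev n G≥M GL′ remaining in G≥G′ , G′≥G
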